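{- Let $\Sigma$ be a predictive theory and $A \Rightarrow B$ a predictive formula. Put $\Sigma_{A}^B = \{E+i \Rightarrow F+i \mid E \Rightarrow F \in \Sigma,\ i \in \mathbb{Z},\ l(A)-l(E) \leq i \leq u(B)-l(F)\}$. Then $\Sigma \vdash A \Rightarrow B$ if and only if $\Sigma_{A}^B \vdash_\mathcal{R} A \Rightarrow B$, where $\mathcal{R}$ is the deduction system consisting of (Ax) and (Cut).
   Context: $Y$ is a non-empty finite set of attributes and $\mathcal{T}_Y = \{y^i \mid y \in Y, i \in \mathbb{Z}\}$; $M + j = \{y^{i+j} \mid y^i \in M\}$. A formula is $A \Rightarrow B$ with $A,B$ finite subsets of $\mathcal{T}_Y$; a theory is a set of formulas. For finite non-empty $M \subseteq \mathcal{T}_Y$, $l(M) = \min\{i \mid y^i \in M\}$ and $u(M) = \max\{i \mid y^i \in M\}$. A formula $A \Rightarrow B$ is predictive if $A \neq \emptyset$, $B \neq \emptyset$ and $i \leq j$ for all $x^i \in A$, $y^j \in B$ (equivalently $u(A) \le l(B)$); a theory is predictive if all its formulas are. Deduction rules (for arbitrary finite $A,B,C,D \subseteq \mathcal{T}_Y$, $i \in \mathbb{Z}$): (Ax) infer $A \cup B \Rightarrow A$; (Cut) from $A \Rightarrow B$ and $B \cup C \Rightarrow D$ infer $A \cup C \Rightarrow D$; (Shf) from $A \Rightarrow B$ infer $A+i \Rightarrow B+i$. For a set of rules $\mathcal{R}$, $\Sigma \vdash_\mathcal{R} A \Rightarrow B$ means there is a finite sequence ending with $A \Rightarrow B$ each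 member of which is in $\Sigma$ or follows from earlier members by a rule of $\mathcal{R}$; $\vdash$ denotes $\vdash_\mathcal{R}$ for $\mathcal{R}$ = \{(Ax), (Cut), (Shf)\}. -}

module Defs where

open import Data.Integer.Base using (ℤ; _+_; _-_; _≤_)
open import Data.Integer.Properties using (≤-totalOrder)
open import Data.List.Base using (List; []; _∷_; _++_; map)
open import Data.List.Extrema ≤-totalOrder using (min; max)
open import Data.List.Membership.Propositional using (_∈_)
open import Data.List.Relation.Binary.BagAndSetEquality
  using (_∼[_]_; set; [_]-Equality)
open import Data.List.Relation.Unary.All using (All)
open import Data.List.Relation.Unary.Any using (Any)
open import Data.Product.Base using (_×_; _,_; proj₂; ∃)
open import Level using (Level; _⊔_) renaming (suc to ℓsuc)
open import Relation.Binary.Bundles using (Setoid)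
open import Relation.Binary.PropositionalEquality.Core using (_≢_; refl)
open import Relation.Nullary.Negation.Core using (contradiction)
open import Relation.Unary using (Pred)

private
  variable
    a σ : Level
    Y : Set a

-- The pair (y , i) is the attribute y^i.
𝒯 : Set a → Set a
𝒯 Y = Y × ℤ

-- Finite sets are lists taken up to set equality: order and repetition of
-- elements are disregarded wherever two finite sets are compared.
FinSet : Set a → Set a
FinSet Y = List (𝒯 Y)

∅ : FinSet Y
∅ = []

infixr 6 _∪_
_∪_ : FinSet Y → FinSet Y → FinSet Y
_∪_ = _++_

shift : ℤ → FinSet Y → FinSet Y
shift j = map λ (y , i) → (y , i + j)

times : FinSet Y → List ℤ
times = map proj₂

l : (M : FinSet Y) → M ≢ ∅ → ℤ
l []            M≢∅ = contradiction refl M≢∅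
l ((_ , i) ∷ M) _   = min i (times M)

u : (M : FinSet Y) → M ≢ ∅ → ℤ
u []            M≢∅ = contradiction refl M≢∅
u ((_ , i) ∷ M) _   = max i (times M)

infix 5 _⇒_
record Formula (Y : Set a) : Set a where
  constructor _⇒_
  field
    antecedent : FinSet Y
    consequent : FinSet Y

infix 4 _≈_
_≈_ : Formula Y → Formula Y → Set _
(A ⇒ B) ≈ (C ⇒ D) = (A ∼[ set ] C) × (B ∼[ set ] D)

≈-trans : {φ ψ χ : Formula Y} → φ ≈ ψ → ψ ≈ χ → φ ≈ χ
≈-trans {Y = Y} (p , q) (p′ , q′) = S.trans p p′ , S.trans q q′
  where module S = Setoid ([ set ]-Equality (𝒯 Y))

record Predictive {Y : Set a} (φ : Formula Y) : Set a where
  open Formula φ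
  field
    antecedent≢∅ : antecedent ≢ ∅
    consequent≢∅ : consequent ≢ ∅
    ordered      : ∀ {x i y j} → (x , i) ∈ antecedent → (y , j) ∈ consequent → i ≤ j

-- A set of formulas cannot distinguish two list representations of the same
-- formula, hence the second field.
record Theory (Y : Set a) (σ : Level) : Set (a ⊔ ℓsuc σ) where
  field
    Member : Pred (Formula Y) σ
    resp   : ∀ {φ ψ} → φ ≈ ψ → Member φ → Member ψ

infix 4 _∈ᵀ_
_∈ᵀ_ : Formula Y → Theory Y σ → Set σ
φ ∈ᵀ Σ = Theory.Member Σ φ

PredictiveTheory : Theory Y σ → Set _
PredictiveTheory Σ = ∀ {φ} → φ ∈ᵀ Σ → Predictive φ

data Rule : Set where
  Ax Cut Shf : Rule

data Inference {Y : Set a} : Rule → List (Formula Y) → Formula Y → Set a where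
  ax  : ∀ A B     → Inference Ax  [] (A ∪ B ⇒ A)
  cut : ∀ A B C D → Inference Cut ((A ⇒ B) ∷ (B ∪ C ⇒ D) ∷ []) (A ∪ C ⇒ D)
  shf : ∀ A B i   → Inference Shf ((A ⇒ B) ∷ []) (shift i A ⇒ shift i B)

data Justified {Y : Set a} (Σ : Theory Y σ) (ℛ : List Rule)
               (earlier : List (Formula Y)) (φ : Formula Y) : Set (a ⊔ σ) where
  hypothesis : φ ∈ᵀ Σ → Justified Σ ℛ earlier φ
  inferred   : ∀ {r premises ψ} → r ∈ ℛ → Inference r premises ψ →
               All (λ π → Any (π ≈_) earlier) premises → ψ ≈ φ →
               Justified Σ ℛ earlier φ

-- The sequence is stored in reverse, so that its last member is the head.
data Proof {Y : Set a} (Σ : Theory Y σ) (ℛ : List Rule) :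
           List (Formula Y) → Set (a ⊔ σ) where
  []  : Proof Σ ℛ []
  _∷_ : ∀ {φ φs} → Justified Σ ℛ φs φ → Proof Σ ℛ φs → Proof Σ ℛ (φ ∷ φs)

infix 3 _⊢[_]_ _⊢_
_⊢[_]_ : Theory Y σ → List Rule → Formula Y → Set _
Σ ⊢[ ℛ ] φ = ∃ λ φs → Proof Σ ℛ (φ ∷ φs)

_⊢_ : Theory Y σ → Formula Y → Set _
Σ ⊢ φ = Σ ⊢[ Ax ∷ Cut ∷ Shf ∷ [] ] φ

-- The theory Σ_A^B. The predictivity proofs supply the non-emptiness needed
-- for l and u to be defined.
module _ {Y : Set a} (Σ : Theory Y σ) (Σ-pred : PredictiveTheory Σ)
         (A B : FinSet Y) (AB-pred : Predictive (A ⇒ B)) where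
  open Predictive

  record Restricted (φ : Formula Y) : Set (a ⊔ σ) where
    field
      E F   : FinSet Y
      i     : ℤ
      E⇒F∈Σ : (E ⇒ F) ∈ᵀ Σ
      lower : l A (antecedent≢∅ AB-pred) - l E (antecedent≢∅ (Σ-pred E⇒F∈Σ)) ≤ i
      upper : i ≤ u B (consequent≢∅ AB-pred) - l F (consequent≢∅ (Σ-pred E⇒F∈Σ))
      equal : (shift i E ⇒ shift i F) ≈ φ

  restrict : Theory Y (a ⊔ σ)
  restrict = record
    { Member = Restricted
    ; resp   = λ φ≈ψ r → let open Restricted r in
        record { E = E ; F = F ; i = i ; E⇒F∈Σ = E⇒F∈Σ ; lower = lower
               ; upper = upper ; equal = ≈-trans equal φ≈ψ }
    }

{-# OPTIONS --safe #-}

-- Σ ⊢ A ⇒ B holds iff every attribute of B can be reached from A by forward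
-- chaining with shifted formulas of Σ.  For predictive Σ such chaining never
-- moves back in time: all reached attributes are at time ≥ l(A), and a firing
-- that contributes to an attribute at time ≤ u(B) only uses premises at time
-- ≤ u(B).  Hence every shift E+i ⇒ F+i used on the way to B satisfies
-- l(A) ≤ l(E)+i and l(F)+i ≤ u(B), which are the bounds defining Σ_A^B.
module Submission where

open import Defs
open import Data.Fin.Base using (Fin)
open import Data.Integer.Base using (0ℤ; _+_; _-_; -_; _≤_)
open import Data.Integer.Properties
  using ( ≤-trans; ≤-reflexive; ≤-totalOrder; module ≤-Reasoning
        ; +-monoˡ-≤; +-comm; +-assoc; +-identityʳ; +-inverseʳ)
open import Data.List.Base using (List; []; _∷_; _++_; [_])
open import Data.List.Extrema ≤-totalOrder
  using (argmin-sel; min≤⊤; min≤xs; ⊥≤max; xs≤max)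
open import Data.List.Membership.Propositional using (_∈_)
open import Data.List.Membership.Propositional.Properties
  using (∈-map⁺; ∈-map⁻; ∈-++⁻; ∈-++⁺ˡ; ∈-++⁺ʳ)
open import Data.List.Properties using (++-identityʳ)
open import Data.List.Relation.Binary.BagAndSetEquality using (_∼[_]_; set)
open import Data.List.Relation.Binary.Subset.Propositional using (_⊆_)
open import Data.List.Relation.Unary.All as All using (All; []; _∷_)
open import Data.List.Relation.Unary.Any using (Any; here; there)
open import Data.List.Relation.Unary.Any.Properties using (++⁺ˡ; ++⁺ʳ)
open import Data.Nat.Base using (ℕ; suc)
open import Data.Product.Base using (_×_; _,_; proj₁; proj₂; ∃)
open import Data.Sum.Base using (inj₁; inj₂; [_,_]′)
open import Function.Base using (id; _∘_)
open import Function.Bundles using (_↔_; _⇔_; mk⇔; module Equivalence)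
open import Level using (Level; _⊔_)
open import Relation.Binary.PropositionalEquality
  using (_≡_; _≢_; refl; sym; cong; subst)
open import Relation.Nullary.Negation.Core using (contradiction)
open import Relation.Unary using (Pred)

private
  variable
    a p σ : Level
    Y : Set a
    Σ : Theory Y σ
    ℛ : List Rule
    A B M : FinSet Y
    φ ψ : Formula Y

-- Set equality of lists.

⊆-antisym : A ⊆ B → B ⊆ A → A ∼[ set ] B
⊆-antisym A⊆B B⊆A = mk⇔ A⊆B B⊆A

∼-refl : A ∼[ set ] A
∼-refl = ⊆-antisym id id

∼-sym : A ∼[ set ] B → B ∼[ set ] A
∼-sym p = mk⇔ (Equivalence.from p) (Equivalence.to p)

≈-refl : φ ≈ φ
≈-refl = ∼-refl , ∼-refl

≈-sym : φ ≈ ψ → ψ ≈ φ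
≈-sym (p , q) = ∼-sym p , ∼-sym q

∪-absorbˡ : M ⊆ A → M ∪ A ∼[ set ] A
∪-absorbˡ {M = M} M⊆A = ⊆-antisym ([ M⊆A , id ]′ ∘ ∈-++⁻ M) (∈-++⁺ʳ M)

∪-comm : (A B : FinSet Y) → A ∪ B ∼[ set ] B ∪ A
∪-comm A B = ⊆-antisym (swap A B) (swap B A)
  where
  swap : ∀ C D → C ∪ D ⊆ D ∪ C
  swap C D = [ ∈-++⁺ʳ D , ∈-++⁺ˡ ]′ ∘ ∈-++⁻ C

-- Shifts and extremal times.

∈-shift⁺ : ∀ {y j} i → (y , j) ∈ M → (y , j + i) ∈ shift i M
∈-shift⁺ i = ∈-map⁺ _

∈-shift⁻ : ∀ {y k} i → (y , k) ∈ shift i M → ∃ λ j → (y , j) ∈ M × k ≡ j + i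
∈-shift⁻ i y∈ with (_ , j) , y∈M , refl ← ∈-map⁻ _ y∈ = j , y∈M , refl

l-lower : ∀ {y j} (M≢∅ : M ≢ ∅) → (y , j) ∈ M → l M M≢∅ ≤ j
l-lower {M = []} M≢∅ _ = contradiction refl M≢∅
l-lower {M = (_ , i) ∷ M} _ (here refl) = min≤⊤ i (times M)
l-lower {M = (_ , i) ∷ M} _ (there y∈M) =
  All.lookup (min≤xs i (times M)) (∈-map⁺ proj₂ y∈M)

-- The default value of `min` is the time of the head, so both outcomes of `argmin-sel` point to an
-- element of `M`.
l-attained : (M≢∅ : M ≢ ∅) → ∃ λ y → (y , l M M≢∅) ∈ M
l-attained {M = []} M≢∅ = contradiction refl M≢∅
l-attained {M = (x , i) ∷ M} _ with argmin-sel id i (times M)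
... | inj₁ min≡i = x , here (cong (x ,_) min≡i)
... | inj₂ min∈M with (y , _) , y∈M , min≡j ← ∈-map⁻ proj₂ min∈M =
  y , there (subst (λ j → (y , j) ∈ M) (sym min≡j) y∈M)

u-upper : ∀ {y j} (M≢∅ : M ≢ ∅) → (y , j) ∈ M → j ≤ u M M≢∅
u-upper {M = []} M≢∅ _ = contradiction refl M≢∅
u-upper {M = (_ , i) ∷ M} _ (here refl) = ⊥≤max i (times M)
u-upper {M = (_ , i) ∷ M} _ (there y∈M) =
  All.lookup (xs≤max i (times M)) (∈-map⁺ proj₂ y∈M)

j+i-j≡i : ∀ j i → j + i - j ≡ i
j+i-j≡i j i = begin-equality
  j + i - j    ≡⟨ cong (_- j) (+-comm j i) ⟩
  i + j - j    ≡⟨ +-assoc i j (- j) ⟩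
  i + (j - j)  ≡⟨ cong (i +_) (+-inverseʳ j) ⟩
  i + 0ℤ       ≡⟨ +-identityʳ i ⟩
  i            ∎
  where open ≤-Reasoning

i≤j+k⇒i-j≤k : ∀ {i j k} → i ≤ j + k → i - j ≤ k
i≤j+k⇒i-j≤k {i} {j} {k} i≤j+k =
  ≤-trans (+-monoˡ-≤ (- j) i≤j+k) (≤-reflexive (j+i-j≡i j k))

j+i≤k⇒i≤k-j : ∀ {i j k} → j + i ≤ k → i ≤ k - j
j+i≤k⇒i≤k-j {i} {j} {k} j+i≤k =
  ≤-trans (≤-reflexive (sym (j+i-j≡i j i))) (+-monoˡ-≤ (- j) j+i≤k)

-- Proof sequences and induction on derivability.

Justified-weaken : ∀ {φs φs′} →
  (∀ {π} → Any (π ≈_) φs → Any (π ≈_) φs′) →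
  Justified Σ ℛ φs φ → Justified Σ ℛ φs′ φ
Justified-weaken f (hypothesis φ∈Σ) = hypothesis φ∈Σ
Justified-weaken f (inferred r∈ℛ inf earlier eq) =
  inferred r∈ℛ inf (All.map f earlier) eq

Proof-++ : ∀ {φs φs′} → Proof Σ ℛ φs → Proof Σ ℛ φs′ → Proof Σ ℛ (φs ++ φs′)
Proof-++ []      ρ′ = ρ′
-- Storage is reversed: `φs′` precedes `φs`, so the justifications in `φs` gain earlier lines.
Proof-++ (j ∷ ρ) ρ′ = Justified-weaken ++⁺ˡ j ∷ Proof-++ ρ ρ′

-- An inference draws all its premises from one sequence, so separate derivations are first
-- concatenated.
collect : ∀ {premises} → All (Σ ⊢[ ℛ ]_) premises →
          ∃ λ φs → Proof Σ ℛ φs × All (λ π → Any (π ≈_) φs) premises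
collect [] = [] , [] , []
collect ((φs , ρ) ∷ ps) with φs′ , ρ′ , earlier ← collect ps =
  _ , Proof-++ ρ ρ′ , here ≈-refl ∷ All.map (++⁺ʳ (_ ∷ φs)) earlier

⊢-hyp : φ ∈ᵀ Σ → Σ ⊢[ ℛ ] φ
⊢-hyp φ∈Σ = [] , hypothesis φ∈Σ ∷ []

⊢-infer : ∀ {r premises} → r ∈ ℛ → Inference r premises φ →
          All (Σ ⊢[ ℛ ]_) premises → Σ ⊢[ ℛ ] φ
⊢-infer r∈ℛ inf ps with φs , ρ , earlier ← collect ps =
  φs , inferred r∈ℛ inf earlier ≈-refl ∷ ρ

⊢-resp : φ ≈ ψ → Σ ⊢[ ℛ ] φ → Σ ⊢[ ℛ ] ψ
⊢-resp {Σ = Σ} φ≈ψ (φs , hypothesis φ∈Σ ∷ ρ) =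
  φs , hypothesis (Theory.resp Σ φ≈ψ φ∈Σ) ∷ ρ
⊢-resp φ≈ψ (φs , inferred r∈ℛ inf earlier eq ∷ ρ) =
  φs , inferred r∈ℛ inf earlier (≈-trans eq φ≈ψ) ∷ ρ

module _ {Y : Set a} {Σ : Theory Y σ} {ℛ : List Rule} (P : Pred (Formula Y) p)
         (P-resp : ∀ {φ ψ} → φ ≈ ψ → P φ → P ψ)
         (P-hyp : ∀ {φ} → φ ∈ᵀ Σ → P φ)
         (P-infer : ∀ {r premises φ} → r ∈ ℛ → Inference r premises φ →
                    All P premises → P φ) where

  -- Lines match the premises and conclusion of an inference only up to `≈`, so `P-resp` is applied
  -- on both sides of `P-infer`.
  Proof-induction : ∀ {φs} → Proof Σ ℛ φs → All P φs
  Proof-induction [] = []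
  Proof-induction (hypothesis φ∈Σ ∷ ρ) = P-hyp φ∈Σ ∷ Proof-induction ρ
  Proof-induction (inferred r∈ℛ inf earlier eq ∷ ρ) =
    P-resp eq (P-infer r∈ℛ inf (All.map premise earlier)) ∷ Ps
    where
    Ps = Proof-induction ρ
    premise : ∀ {π} → Any (π ≈_) _ → P π
    premise π∈ with Pχ , π≈χ ← All.lookupAny Ps π∈ = P-resp (≈-sym π≈χ) Pχ

  ⊢-induction : ∀ {φ} → Σ ⊢[ ℛ ] φ → P φ
  ⊢-induction (_ , ρ) = All.head (Proof-induction ρ)

-- Derived rules from (Ax) and (Cut).

module _ {Y : Set a} {Σ : Theory Y σ} {ℛ : List Rule} where

  -- The instance of `ax` used has antecedent `M ∪ A`, which collapses to `A` when `M ⊆ A`.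
  ⊢-⊆ : Ax ∈ ℛ → ∀ {A M} → M ⊆ A → Σ ⊢[ ℛ ] A ⇒ M
  ⊢-⊆ ax∈ M⊆A =
    ⊢-resp (∪-absorbˡ M⊆A , ∼-refl) (⊢-infer ax∈ (ax _ _) [])

  ⊢-cut : Cut ∈ ℛ → ∀ {A B C D} →
          Σ ⊢[ ℛ ] A ⇒ B → Σ ⊢[ ℛ ] B ∪ C ⇒ D → Σ ⊢[ ℛ ] A ∪ C ⇒ D
  ⊢-cut cut∈ d e = ⊢-infer cut∈ (cut _ _ _ _) (d ∷ e ∷ [])

  ⊢-trans : Cut ∈ ℛ → ∀ {A B D} →
            Σ ⊢[ ℛ ] A ⇒ B → Σ ⊢[ ℛ ] B ⇒ D → Σ ⊢[ ℛ ] A ⇒ D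
  ⊢-trans cut∈ {A} {B} {D} d e =
    -- This is (Cut) with `C` empty.
    subst (λ X → Σ ⊢[ ℛ ] X ⇒ D) (++-identityʳ A)
      (⊢-cut cut∈ d (subst (λ X → Σ ⊢[ ℛ ] X ⇒ D) (sym (++-identityʳ B)) e))

  -- Cutting `e` into the axiom on `N ∪ M` leaves the antecedent `A ∪ M`; cutting `d` into the
  -- result leaves `A ∪ A`, which collapses to `A`.
  ⊢-∪ : Ax ∈ ℛ → Cut ∈ ℛ → ∀ {A M N} →
        Σ ⊢[ ℛ ] A ⇒ M → Σ ⊢[ ℛ ] A ⇒ N → Σ ⊢[ ℛ ] A ⇒ M ∪ N
  ⊢-∪ ax∈ cut∈ {A} {M} {N} d e =
    ⊢-resp (∪-absorbˡ id , ∼-refl) (⊢-cut cut∈ d M∪A⇒M∪N)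
    where
    A∪M⇒M∪N : Σ ⊢[ ℛ ] A ∪ M ⇒ M ∪ N
    A∪M⇒M∪N = ⊢-cut cut∈ e (⊢-resp (∼-refl , ∪-comm N M) (⊢-⊆ ax∈ id))
    M∪A⇒M∪N : Σ ⊢[ ℛ ] M ∪ A ⇒ M ∪ N
    M∪A⇒M∪N = ⊢-resp (∪-comm A M , ∼-refl) A∪M⇒M∪N

  ⊢-pointwise : Ax ∈ ℛ → Cut ∈ ℛ → ∀ {A} M →
                (∀ {x} → x ∈ M → Σ ⊢[ ℛ ] A ⇒ [ x ]) → Σ ⊢[ ℛ ] A ⇒ M
  ⊢-pointwise ax∈ cut∈ []      d = ⊢-⊆ ax∈ λ ()
  ⊢-pointwise ax∈ cut∈ (x ∷ M) d =
    ⊢-∪ ax∈ cut∈ (d (here refl)) (⊢-pointwise ax∈ cut∈ M (d ∘ there))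

-- Forward chaining.

data Closure {Y : Set a} (Σ : Theory Y σ) (A : FinSet Y) : Pred (𝒯 Y) (a ⊔ σ) where
  base : ∀ {x} → x ∈ A → Closure Σ A x
  -- The shift is built into each firing, so `A` stays fixed and every antecedent attribute carries
  -- its own subtree for recursion.
  step : ∀ {E F} → (E ⇒ F) ∈ᵀ Σ → ∀ i →
         (∀ {y j} → (y , j) ∈ E → Closure Σ A (y , j + i)) →
         ∀ {y j} → (y , j) ∈ F → Closure Σ A (y , j + i)

-- Grafts trees onto the leaves; this is how closures absorb (Cut).
Closure-bind : ∀ {x} → (∀ {y} → y ∈ A → Closure Σ B y) →
               Closure Σ A x → Closure Σ B x
Closure-bind f (base x∈A)            = f x∈A
Closure-bind f (step E⇒F∈Σ i cs x∈F) =
  step E⇒F∈Σ i (λ y∈E → Closure-bind f (cs y∈E)) x∈F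

-- Moving the leaves by `i` turns a firing at shift `j` into one at `j + i`; associativity realigns
-- the times.
Closure-shift : ∀ i {y k} → Closure Σ A (y , k) → Closure Σ (shift i A) (y , k + i)
Closure-shift i (base x∈A) = base (∈-shift⁺ i x∈A)
Closure-shift {Σ = Σ} {A = A} i (step E⇒F∈Σ j cs {y} {k} x∈F) =
  subst (λ t → Closure Σ (shift i A) (y , t)) (sym (+-assoc k j i))
    (step E⇒F∈Σ (j + i)
      (λ {z} {m} z∈E → subst (λ t → Closure Σ (shift i A) (z , t)) (+-assoc m j i)
                          (Closure-shift i (cs z∈E)))
      x∈F)

-- `Valid` survives (Cut) by `Closure-bind` and (Shf) by `Closure-shift`; a formula of `Σ` is a
-- single firing at shift 0.
Closure-sound : Σ ⊢ (A ⇒ B) → ∀ {x} → x ∈ B → Closure Σ A x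
Closure-sound {Σ = Σ} d = ⊢-induction Valid resp hyp infer d
  where
  Valid : Pred (Formula _) _
  Valid (A ⇒ B) = ∀ {x} → x ∈ B → Closure Σ A x

  resp : φ ≈ ψ → Valid φ → Valid ψ
  resp (A∼C , B∼D) v x∈D =
    Closure-bind (base ∘ Equivalence.to A∼C) (v (Equivalence.from B∼D x∈D))

  hyp : φ ∈ᵀ Σ → Valid φ
  hyp {φ = A ⇒ B} φ∈Σ {y , k} x∈B =
    subst (λ t → Closure Σ A (y , t)) (+-identityʳ k)
      (step φ∈Σ 0ℤ
        (λ {z} {j} z∈A → base (subst (λ t → (z , t) ∈ A) (sym (+-identityʳ j)) z∈A))
        x∈B)

  infer : ∀ {r premises} → r ∈ ℛ → Inference r premises φ → All Valid premises → Valid φ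
  infer _ (ax A B) [] x∈A = base (∈-++⁺ˡ x∈A)
  infer _ (cut A B C D) (v ∷ w ∷ []) x∈D = Closure-bind
    ([ Closure-bind (base ∘ ∈-++⁺ˡ) ∘ v , base ∘ ∈-++⁺ʳ A ]′ ∘ ∈-++⁻ B) (w x∈D)
  infer _ (shf A B i) (v ∷ []) x∈ with j , x∈B , refl ← ∈-shift⁻ i x∈ =
    Closure-shift i (v x∈B)

-- Time bounds from predictivity.

module _ {Y : Set a} (Σ : Theory Y σ) (Σ-pred : PredictiveTheory Σ) where
  open Predictive

  -- Non-emptiness of `E` supplies an antecedent attribute for the induction, and `ordered` places
  -- the conclusion no earlier.
  Closure-lower : (A≢∅ : A ≢ ∅) → ∀ {y k} → Closure Σ A (y , k) → l A A≢∅ ≤ k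
  Closure-lower A≢∅ (base x∈A) = l-lower A≢∅ x∈A
  Closure-lower A≢∅ (step E⇒F∈Σ i cs x∈F)
    with _ , e∈E ← l-attained (antecedent≢∅ (Σ-pred E⇒F∈Σ)) =
    ≤-trans (Closure-lower A≢∅ (cs e∈E))
            (+-monoˡ-≤ i (ordered (Σ-pred E⇒F∈Σ) e∈E x∈F))

  module _ {A B : FinSet Y} (AB-pred : Predictive (A ⇒ B)) where

    private
      ℛ₀ : List Rule
      ℛ₀ = Ax ∷ Cut ∷ []

      Σ₀ : Theory Y _
      Σ₀ = restrict Σ Σ-pred A B AB-pred

      ax∈ : Ax ∈ ℛ₀
      ax∈ = here refl

      cut∈ : Cut ∈ ℛ₀
      cut∈ = there (here refl)

    -- The upper bound passes from the conclusion of a firing to its antecedents, which `ordered`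
    -- places no later.
    Closure-complete : ∀ {y k} → Closure Σ A (y , k) →
                       k ≤ u B (consequent≢∅ AB-pred) → Σ₀ ⊢[ ℛ₀ ] A ⇒ [ y , k ]
    Closure-complete (base x∈A) _ = ⊢-⊆ ax∈ λ { (here refl) → x∈A }
    Closure-complete (step {E} {F} E⇒F∈Σ i cs {y} {k} x∈F) k+i≤u =
      ⊢-trans cut∈ (⊢-trans cut∈ A⇒E+i (⊢-hyp E+i⇒F+i∈Σ₀))
        -- Only the requested attribute is kept; others in `shift i F` may lie after `u(B)`.
        (⊢-⊆ ax∈ λ { (here refl) → ∈-shift⁺ i x∈F })
      where
      E⇒F-pred = Σ-pred E⇒F∈Σ
      E≢∅ = antecedent≢∅ E⇒F-pred
      F≢∅ = consequent≢∅ E⇒F-pred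

      premise : ∀ {x} → x ∈ shift i E → Σ₀ ⊢[ ℛ₀ ] A ⇒ [ x ]
      premise x∈ with j , z∈E , refl ← ∈-shift⁻ i x∈ = Closure-complete (cs z∈E)
        (≤-trans (+-monoˡ-≤ i (ordered E⇒F-pred z∈E x∈F)) k+i≤u)

      A⇒E+i : Σ₀ ⊢[ ℛ₀ ] A ⇒ shift i E
      A⇒E+i = ⊢-pointwise ax∈ cut∈ (shift i E) premise

      E+i⇒F+i∈Σ₀ : (shift i E ⇒ shift i F) ∈ᵀ Σ₀
      E+i⇒F+i∈Σ₀ = record
        { E⇒F∈Σ = E⇒F∈Σ
        -- The earliest attribute of `E` is reached at time `l(E) + i`, hence not before `l(A)`.
        ; lower = i≤j+k⇒i-j≤k
            (Closure-lower (antecedent≢∅ AB-pred) (cs (proj₂ (l-attained E≢∅))))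
        -- Here `l(F) + i ≤ k + i ≤ u(B)`.
        ; upper = j+i≤k⇒i≤k-j (≤-trans (+-monoˡ-≤ i (l-lower F≢∅ x∈F)) k+i≤u)
        ; equal = ≈-refl
        }

    restrict-complete : Σ ⊢ (A ⇒ B) → Σ₀ ⊢[ ℛ₀ ] A ⇒ B
    restrict-complete d = ⊢-pointwise ax∈ cut∈ B λ x∈B →
      Closure-complete (Closure-sound d x∈B) (u-upper (consequent≢∅ AB-pred) x∈B)

    -- Up to `≈`, a member of `Σ₀` is a shift of a formula of `Σ`, so one use of (Shf) derives it.
    restrict-sound : Σ₀ ⊢[ ℛ₀ ] φ → Σ ⊢ φ
    restrict-sound = ⊢-induction (Σ ⊢_) ⊢-resp
      (λ φ∈Σ₀ → let open Restricted φ∈Σ₀ in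
        ⊢-resp equal (⊢-infer (there (there (here refl))) (shf E F i)
                               (⊢-hyp E⇒F∈Σ ∷ [])))
      -- `ℛ₀` is an initial segment of the full list of rules.
      (⊢-infer ∘ ∈-++⁺ˡ)

theorem14 : ∀ {a σ : Level} {Y : Set a} (n : ℕ) → Y ↔ Fin (suc n) →
    (Σ : Theory Y σ) (Σ-pred : PredictiveTheory Σ)
    (A B : FinSet Y) (AB-pred : Predictive (A ⇒ B)) →
    (Σ ⊢ (A ⇒ B)) ⇔ (restrict Σ Σ-pred A B AB-pred ⊢[ Ax ∷ Cut ∷ [] ] (A ⇒ B))
theorem14 n Y↔Fin Σ Σ-pred A B AB-pred =
  mk⇔ (restrict-complete Σ Σ-pred AB-pred) (restrict-sound Σ Σ-pred AB-pred)
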